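{- Let $q$ be a power of an odd prime, $k\ge1$, let $S=\{x\in\mathbb F_q^d:\|x\|=1\}$ and $E\subset S$ with $|E|\gtrsim q^{\frac{d+k-1}{2}}$. For $y^1,\dots,y^k\in E$ let $\Delta_{y^1,\dots,y^k}(E)=\{(\|x-y^1\|,\dots,\|x-y^k\|)\in\mathbb F_q^k: x\in E\}$. Then $$\frac1{|E|^k}\sum_{y^1,\dots,y^k\in E}|\Delta_{y^1,\dots,y^k}(E)|\gtrsim q^k.$$
   Context: $\mathbb F_q$ is the finite field with $q$ elements; $\|x\|=x_1^2+\dots+x_d^2$. $X\gtrsim Y$ means $X\ge cY$ for a constant $c>0$ independent of $q$ and $E$; the hypothesis means $|E|\ge c_0q^{(d+k-1)/2}$ for a fixed constant $c_0>0$. -}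

module Defs where

open import Data.Nat using (ℕ; zero; suc)
open import Data.Fin using (Fin)
open import Data.Fin.Properties using (_≟_)
open import Data.Vec using (Vec; []; _∷_; foldr; zipWith)
open import Data.Vec.Properties using (≡-dec)
open import Data.List using (List; []; _∷_; map; concatMap; length; deduplicate)
open import Data.List.Relation.Unary.All using (All)
open import Data.List.Relation.Unary.Unique.Propositional using (Unique)
open import Data.Product using (∃)
open import Relation.Binary.PropositionalEquality using (_≡_; _≢_)
open import Algebra.Structures using (IsCommutativeRing)

-- A finite field with exactly q elements, with carrier Fin q (any finite field
-- of order q is isomorphic to one of this form).
record FiniteField (q : ℕ) : Set where
  field
    _+_ _*_ : Fin q → Fin q → Fin q
    -_      : Fin q → Fin q
    0# 1#   : Fin q
    isCommutativeRing : IsCommutativeRing _≡_ _+_ _*_ -_ 0# 1#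
    0≢1     : 0# ≢ 1#
    inverse : ∀ x → x ≢ 0# → ∃ λ y → (x * y) ≡ 1#

module _ {q : ℕ} (F : FiniteField q) where
  open FiniteField F

  norm : ∀ {d} → Vec (Fin q) d → Fin q
  norm = foldr _ (λ a s → (a * a) + s) 0#

  vsub : ∀ {d} → Vec (Fin q) d → Vec (Fin q) d → Vec (Fin q) d
  vsub = zipWith (λ a b → a + (- b))

  InSphere : ∀ {d} → Vec (Fin q) d → Set
  InSphere x = norm x ≡ 1#

  distVec : ∀ {d k} → Vec (Vec (Fin q) d) k → Vec (Fin q) d → Vec (Fin q) k
  distVec [] x = []
  distVec (y ∷ ys) x = norm (vsub x y) ∷ distVec ys x

  pinnedCard : ∀ {d k} → List (Vec (Fin q) d) → Vec (Vec (Fin q) d) k → ℕ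
  pinnedCard E ys = length (deduplicate (≡-dec _≟_) (map (distVec ys) E))

tuples : ∀ {A : Set} (k : ℕ) → List A → List (Vec A k)
tuples zero    xs = [] ∷ []
tuples (suc k) xs = concatMap (λ x → map (x ∷_) (tuples k xs)) xs

{-# OPTIONS --safe #-}

-- On the unit sphere ‖x − y‖ = 2 − 2 x·y, so ‖x − y‖ = ‖x′ − y‖ forces x·y = x′·y. For a weight f on
-- E with mass F and P(z) = Σ f(x) f(x′) over the pairs with x·z = x′·z, Cauchy–Schwarz gives
-- q P(z) ≥ F² for every z, while counting hyperplanes gives Σ_z (q P(z) − F²) ≤ (q − 1) q^d Σ f².
-- P is invariant under z ↦ c z for c ≠ 0, and every z is such a multiple c y of a point y ∈ E in at
-- most two ways, as ‖c y‖ = c². Hence Σ_{y ∈ E} (q P(y) − F²) ≤ 2 q^d Σ f². Adding the pins one at a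
-- time bounds the number of (x, x′, y¹, …, yᵏ) with ‖x − yⁱ‖ = ‖x′ − yⁱ‖ for all i by
-- |E|^(k+2) / q^k + 2 k q^(d−1) |E|^(k+1), and Cauchy–Schwarz turns this into the lower bound.

module Submission where

open import Defs
open import Data.Nat using (ℕ; zero; suc; _+_; _*_; _^_; _≤_; _∸_; _%_; z≤n; s≤s; >-nonZero)
open import Data.Nat.Properties hiding (_≟_)
open import Data.Nat.Divisibility using (_∣_; divides; n∣m⇒m%n≡0)
open import Data.Nat.Tactic.RingSolver using (solve-∀)
open import Data.Fin using (Fin)
open import Data.Fin.Properties using (_≟_)
open import Data.Vec using (Vec; []; _∷_)
import Data.Vec as Vec
open import Data.Vec.Properties using (≡-dec; ∷-injective)
open import Data.List using (List; []; _∷_; length; map; concatMap; allFin)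
open import Data.List.Properties using (map-++; map-∘; length-tabulate)
open import Data.Nat.ListAction using (sum)
open import Data.Nat.ListAction.Properties using (sum-++)
open import Data.List.Membership.Propositional using (_∈_)
open import Data.List.Membership.Propositional.Properties using (∈-allFin; ∈-map⁺; ∈-deduplicate⁺)
open import Data.List.Relation.Unary.Any using (here; there)
open import Data.List.Relation.Unary.All as All using (All; []; _∷_)
open import Data.List.Relation.Unary.Unique.Propositional using (Unique; []; _∷_)
open import Data.List.Relation.Unary.Unique.Propositional.Properties using (allFin⁺)
open import Data.List.Relation.Unary.Unique.DecPropositional.Properties using (deduplicate-!)
open import Data.Product using (Σ; _×_; _,_; proj₁; proj₂)
open import Data.Sum using (inj₁; inj₂)
open import Data.Bool using (if_then_else_)
open import Function using (_∘_; id)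
open import Level using (0ℓ)
open import Relation.Nullary using (Dec; yes; no; does; ¬_; ¬?; contradiction)
open import Relation.Binary using (DecidableEquality)
open import Relation.Binary.PropositionalEquality using (_≡_; _≢_; refl; sym; trans; cong; cong₂; subst)
open import Algebra.Bundles using (CommutativeRing)
import Algebra.Solver.Ring.NaturalCoefficients.Default as SemiringSolver
import Algebra.Properties.Ring as RingProperties

private
  variable
    A B : Set
    P Q : Set

-- Finite sums over lists

∑ : List A → (A → ℕ) → ℕ
∑ xs f = sum (map f xs)

syntax ∑ xs (λ x → e) = ∑[ x ∈ xs ] e

∑-mono : ∀ {f g : A → ℕ} xs → (∀ {x} → x ∈ xs → f x ≤ g x) → ∑ xs f ≤ ∑ xs g
∑-mono []       h = z≤n
∑-mono (x ∷ xs) h = +-mono-≤ (h (here refl)) (∑-mono xs (h ∘ there))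

∑-cong : ∀ {f g : A → ℕ} xs → (∀ x → f x ≡ g x) → ∑ xs f ≡ ∑ xs g
∑-cong []       h = refl
∑-cong (x ∷ xs) h = cong₂ _+_ (h x) (∑-cong xs h)

∑-+ : ∀ (f g : A → ℕ) xs → ∑[ x ∈ xs ] (f x + g x) ≡ ∑ xs f + ∑ xs g
∑-+ f g []       = refl
∑-+ f g (x ∷ xs) = trans (cong (f x + g x +_) (∑-+ f g xs)) (interchange (f x) (g x) _ _)
  where
  interchange : ∀ a b c d → a + b + (c + d) ≡ a + c + (b + d)
  interchange = solve-∀

∑-*ˡ : ∀ c (f : A → ℕ) xs → c * ∑ xs f ≡ ∑[ x ∈ xs ] (c * f x)
∑-*ˡ c f []       = *-zeroʳ c
∑-*ˡ c f (x ∷ xs) = trans (*-distribˡ-+ c (f x) _) (cong (c * f x +_) (∑-*ˡ c f xs))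

∑-*ʳ : ∀ c (f : A → ℕ) xs → ∑ xs f * c ≡ ∑[ x ∈ xs ] (f x * c)
∑-*ʳ c f []       = refl
∑-*ʳ c f (x ∷ xs) = trans (*-distribʳ-+ c (f x) _) (cong (f x * c +_) (∑-*ʳ c f xs))

∑-const : ∀ c (xs : List A) → ∑[ x ∈ xs ] c ≡ length xs * c
∑-const c []       = refl
∑-const c (x ∷ xs) = cong (c +_) (∑-const c xs)

∑-swap : ∀ (f : A → B → ℕ) xs ys →
         ∑[ x ∈ xs ] ∑[ y ∈ ys ] f x y ≡ ∑[ y ∈ ys ] ∑[ x ∈ xs ] f x y
∑-swap f []       ys = sym (trans (∑-const 0 ys) (*-zeroʳ (length ys)))
∑-swap f (x ∷ xs) ys = trans (cong (∑ ys (f x) +_) (∑-swap f xs ys))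
                             (sym (∑-+ (f x) (λ y → ∑[ x ∈ xs ] f x y) ys))

∑-*-∑ : ∀ (f : A → ℕ) (g : B → ℕ) xs ys →
        ∑ xs f * ∑ ys g ≡ ∑[ x ∈ xs ] ∑[ y ∈ ys ] (f x * g y)
∑-*-∑ f g xs ys = trans (∑-*ʳ (∑ ys g) f xs) (∑-cong xs λ x → ∑-*ˡ (f x) g ys)

∑-concatMap : ∀ (f : B → ℕ) (g : A → List B) xs →
              ∑ (concatMap g xs) f ≡ ∑[ x ∈ xs ] ∑ (g x) f
∑-concatMap f g []       = refl
∑-concatMap f g (x ∷ xs) = trans (cong sum (map-++ f (g x) (concatMap g xs)))
  (trans (sum-++ (map f (g x)) _) (cong (∑ (g x) f +_) (∑-concatMap f g xs)))

∑-tuples : ∀ k (xs : List A) (f : Vec A (suc k) → ℕ) →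
           ∑ (tuples (suc k) xs) f ≡ ∑[ x ∈ xs ] ∑[ v ∈ tuples k xs ] f (x ∷ v)
∑-tuples k xs f = trans (∑-concatMap f (λ x → map (x ∷_) (tuples k xs)) xs)
  (∑-cong xs λ x → cong sum (sym (map-∘ (tuples k xs))))

∑-tuples-const : ∀ k c (xs : List A) → ∑[ v ∈ tuples k xs ] c ≡ length xs ^ k * c
∑-tuples-const zero    c xs = refl
∑-tuples-const (suc k) c xs =
  trans (∑-tuples k xs (λ _ → c))
  (trans (∑-cong xs (λ _ → ∑-tuples-const k c xs))
  (trans (∑-const (length xs ^ k * c) xs) (sym (*-assoc (length xs) _ c))))

∈⇒≤∑ : ∀ (f : A → ℕ) {x xs} → x ∈ xs → f x ≤ ∑ xs f
∈⇒≤∑ f (here refl)          = m≤m+n _ _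
∈⇒≤∑ f {xs = y ∷ _} (there p) = ≤-trans (∈⇒≤∑ f p) (m≤n+m _ (f y))

∑-zero : ∀ {f : A → ℕ} xs → (∀ {x} → x ∈ xs → f x ≡ 0) → ∑ xs f ≡ 0
∑-zero []       h = refl
∑-zero (x ∷ xs) h = cong₂ _+_ (h (here refl)) (∑-zero xs (h ∘ there))

-- Off the diagonal, the entries at `(x, y)` and `(y, x)` pair up. This parity argument later
-- excludes characteristic 2.
∑∑-symmetric-even : ∀ (r : A → A → ℕ) → (∀ x y → r x y ≡ r y x) → (∀ x → r x x ≡ 0) →
                    ∀ xs → 2 ∣ ∑[ x ∈ xs ] ∑[ y ∈ xs ] r x y
∑∑-symmetric-even r r-sym r-diag [] = divides 0 refl
∑∑-symmetric-even r r-sym r-diag (x ∷ xs) with ∑∑-symmetric-even r r-sym r-diag xs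
... | divides m eq = divides (s + m) (begin-equality
  r x x + s + ∑[ y ∈ xs ] (r y x + ∑ xs (r y))
    ≡⟨ cong₂ (λ u v → u + s + v) (r-diag x) (∑-+ (λ y → r y x) (λ y → ∑ xs (r y)) xs) ⟩
  s + (∑[ y ∈ xs ] r y x + ∑[ y ∈ xs ] ∑ xs (r y))
    ≡⟨ cong₂ (λ u v → s + (u + v)) (∑-cong xs (λ y → r-sym y x)) eq ⟩
  s + (s + m * 2)
    ≡⟨ regroup s m ⟩
  (s + m) * 2 ∎)
  where
  open ≤-Reasoning
  s = ∑ xs (r x)
  regroup : ∀ s m → s + (s + m * 2) ≡ (s + m) * 2
  regroup = solve-∀

-- Cauchy–Schwarz

square-cancel-≤ : ∀ {m n} → m * m ≤ n * n → m ≤ n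
square-cancel-≤ m²≤n² = ≮⇒≥ λ n<m → <⇒≱ (*-mono-< n<m n<m) m²≤n²

-- The two sides differ by the square of the difference; the larger number is written as the smaller
-- plus `e`, so that no negative number occurs.
4mn≤[m+n]² : ∀ m n → 4 * (m * n) ≤ (m + n) * (m + n)
4mn≤[m+n]² m n with ≤-total m n
... | inj₁ m≤n = subst (λ n → 4 * (m * n) ≤ (m + n) * (m + n)) (m+[n∸m]≡n m≤n) (ordered m (n ∸ m))
  where
  expand : ∀ m e → (m + (m + e)) * (m + (m + e)) ≡ 4 * (m * (m + e)) + e * e
  expand = solve-∀
  ordered : ∀ m e → 4 * (m * (m + e)) ≤ (m + (m + e)) * (m + (m + e))
  ordered m e = subst (4 * (m * (m + e)) ≤_) (sym (expand m e)) (m≤m+n _ (e * e))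
... | inj₂ n≤m = subst (λ m → 4 * (m * n) ≤ (m + n) * (m + n)) (m+[n∸m]≡n n≤m) (ordered n (m ∸ n))
  where
  expand : ∀ n e → (n + e + n) * (n + e + n) ≡ 4 * ((n + e) * n) + e * e
  expand = solve-∀
  ordered : ∀ n e → 4 * ((n + e) * n) ≤ (n + e + n) * (n + e + n)
  ordered n e = subst (4 * ((n + e) * n) ≤_) (sym (expand n e)) (m≤m+n _ (e * e))

-- Bounding `f x` by the geometric mean of `g x` and `h x` in squared form keeps the inequality free
-- of roots.
cauchy-schwarz : ∀ (f g h : A → ℕ) xs → (∀ x → f x * f x ≤ g x * h x) →
                 ∑ xs f * ∑ xs f ≤ ∑ xs g * ∑ xs h
cauchy-schwarz f g h []       le = z≤n
cauchy-schwarz f g h (x ∷ xs) le = begin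
  (a + F) * (a + F)                       ≡⟨ square-+ a F ⟩
  a * a + F * F + 2 * (a * F)             ≤⟨ +-mono-≤ (+-mono-≤ (le x) ih) cross ⟩
  b * c + G * H + (b * H + c * G)         ≡⟨ expand b G c H ⟨
  (b + G) * (c + H)                       ∎
  where
  open ≤-Reasoning
  a = f x
  b = g x
  c = h x
  F = ∑ xs f
  G = ∑ xs g
  H = ∑ xs h
  ih = cauchy-schwarz f g h xs le
  square-+ : ∀ a F → (a + F) * (a + F) ≡ a * a + F * F + 2 * (a * F)
  square-+ = solve-∀
  expand : ∀ b G c H → (b + G) * (c + H) ≡ b * c + G * H + (b * H + c * G)
  expand = solve-∀
  regroup₁ : ∀ a F → (2 * (a * F)) * (2 * (a * F)) ≡ 4 * ((a * a) * (F * F))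
  regroup₁ = solve-∀
  regroup₂ : ∀ b c G H → (b * c) * (G * H) ≡ (b * H) * (c * G)
  regroup₂ = solve-∀
  -- After squaring, this is AM-GM for `b * H` and `c * G`, whose product bounds the square of
  -- `a * F` by `le x` and the induction hypothesis.
  cross : 2 * (a * F) ≤ b * H + c * G
  cross = square-cancel-≤ (begin
    (2 * (a * F)) * (2 * (a * F))    ≡⟨ regroup₁ a F ⟩
    4 * ((a * a) * (F * F))          ≤⟨ *-monoʳ-≤ 4 (*-mono-≤ (le x) ih) ⟩
    4 * ((b * c) * (G * H))          ≡⟨ cong (4 *_) (regroup₂ b c G H) ⟩
    4 * ((b * H) * (c * G))          ≤⟨ 4mn≤[m+n]² (b * H) (c * G) ⟩
    (b * H + c * G) * (b * H + c * G) ∎)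

-- Indicators

𝟙 : Dec P → ℕ
𝟙 d = if does d then 1 else 0

𝟙-true : (d : Dec P) → P → 𝟙 d ≡ 1
𝟙-true (yes _) p = refl
𝟙-true (no ¬p) p = contradiction p ¬p

𝟙-false : (d : Dec P) → ¬ P → 𝟙 d ≡ 0
𝟙-false (yes p) ¬p = contradiction p ¬p
𝟙-false (no _)  ¬p = refl

𝟙≤1 : (d : Dec P) → 𝟙 d ≤ 1
𝟙≤1 (yes _) = ≤-refl
𝟙≤1 (no _)  = z≤n

𝟙-mono : (d : Dec P) (e : Dec Q) → (P → Q) → 𝟙 d ≤ 𝟙 e
𝟙-mono (yes p) e h = ≤-reflexive (sym (𝟙-true e (h p)))
𝟙-mono (no _)  e h = z≤n

∑-𝟙≤1 : ∀ {P : A → Set} (P? : ∀ x → Dec (P x)) → (∀ {x y} → P x → P y → x ≡ y) →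
        ∀ {xs} → Unique xs → ∑[ x ∈ xs ] 𝟙 (P? x) ≤ 1
∑-𝟙≤1 P? P-prop [] = z≤n
∑-𝟙≤1 P? P-prop {x ∷ xs} (x∉xs ∷ u) with P? x
... | no _  = ∑-𝟙≤1 P? P-prop u
... | yes p = ≤-reflexive (cong suc (∑-zero xs λ {y} y∈xs →
                𝟙-false (P? y) λ p′ → All.lookup x∉xs y∈xs (P-prop p p′)))

-- Fibres of a map and their energy

module Fibres {A B : Set} (_≟_ : DecidableEquality B) where

  -- The sum over the fibres of κ of the square of the f-mass of the fibre.
  energy : List A → (A → ℕ) → (A → B) → ℕ
  energy xs f κ = ∑[ x ∈ xs ] ∑[ x′ ∈ xs ] (f x * f x′ * 𝟙 (κ x ≟ κ x′))

  fibreMass : List A → (A → ℕ) → (A → B) → B → ℕ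
  fibreMass xs f κ t = ∑[ x ∈ xs ] (f x * 𝟙 (κ x ≟ t))

  ∑-fibreMass-≥ : ∀ xs f κ ts → (∀ {x} → x ∈ xs → κ x ∈ ts) → ∑ xs f ≤ ∑ ts (fibreMass xs f κ)
  ∑-fibreMass-≥ xs f κ ts κ∈ts = begin
    ∑ xs f                                       ≤⟨ ∑-mono xs covered ⟩
    ∑[ x ∈ xs ] ∑[ t ∈ ts ] (f x * 𝟙 (κ x ≟ t))  ≡⟨ ∑-swap _ xs ts ⟩
    ∑ ts (fibreMass xs f κ)                      ∎
    where
    open ≤-Reasoning
    covered : ∀ {x} → x ∈ xs → f x ≤ ∑[ t ∈ ts ] (f x * 𝟙 (κ x ≟ t))
    covered {x} x∈xs = begin
      f x                             ≡⟨ *-identityʳ (f x) ⟨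
      f x * 1                         ≡⟨ cong (f x *_) (𝟙-true (κ x ≟ κ x) refl) ⟨
      f x * 𝟙 (κ x ≟ κ x)             ≤⟨ ∈⇒≤∑ (λ t → f x * 𝟙 (κ x ≟ t)) (κ∈ts x∈xs) ⟩
      ∑[ t ∈ ts ] (f x * 𝟙 (κ x ≟ t)) ∎

  ∑-𝟙-≟ : ∀ {ts} → Unique ts → ∀ b → ∑[ t ∈ ts ] 𝟙 (b ≟ t) ≤ 1
  ∑-𝟙-≟ u b = ∑-𝟙≤1 (b ≟_) (λ p p′ → trans (sym p) p′) u

  -- Expanding the squares counts triples `(x, x′, t)` with `κ x = t = κ x′`, and a pair admits at
  -- most one such `t` in a list without repetitions.
  ∑-fibreMass²-≤ : ∀ xs f κ {ts} → Unique ts →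
                   ∑[ t ∈ ts ] (fibreMass xs f κ t * fibreMass xs f κ t) ≤ energy xs f κ
  ∑-fibreMass²-≤ xs f κ {ts} u = begin
    ∑[ t ∈ ts ] (fibreMass xs f κ t * fibreMass xs f κ t)
      ≡⟨ ∑-cong ts (λ t → ∑-*-∑ (λ x → f x * 𝟙 (κ x ≟ t)) (λ x → f x * 𝟙 (κ x ≟ t)) xs xs) ⟩
    ∑[ t ∈ ts ] ∑[ x ∈ xs ] ∑[ x′ ∈ xs ] pair x x′ t
      ≡⟨ ∑-swap (λ t x → ∑[ x′ ∈ xs ] pair x x′ t) ts xs ⟩
    ∑[ x ∈ xs ] ∑[ t ∈ ts ] ∑[ x′ ∈ xs ] pair x x′ t
      ≡⟨ ∑-cong xs (λ x → ∑-swap (λ t x′ → pair x x′ t) ts xs) ⟩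
    ∑[ x ∈ xs ] ∑[ x′ ∈ xs ] ∑[ t ∈ ts ] pair x x′ t
      ≤⟨ ∑-mono xs (λ {x} _ → ∑-mono xs (λ {x′} _ → common x x′)) ⟩
    energy xs f κ ∎
    where
    open ≤-Reasoning
    pair : A → A → B → ℕ
    pair x x′ t = f x * 𝟙 (κ x ≟ t) * (f x′ * 𝟙 (κ x′ ≟ t))
    common : ∀ x x′ → ∑ ts (pair x x′) ≤ f x * f x′ * 𝟙 (κ x ≟ κ x′)
    common x x′ with κ x ≟ κ x′
    ... | yes _ = begin
      ∑ ts (pair x x′)                                 ≤⟨ ∑-mono ts (λ {t} _ → *-mono-≤
          (≤-refl {f x * 𝟙 (κ x ≟ t)}) (*-monoʳ-≤ (f x′) (𝟙≤1 (κ x′ ≟ t)))) ⟩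
      ∑[ t ∈ ts ] (f x * 𝟙 (κ x ≟ t) * (f x′ * 1))     ≡⟨ ∑-cong ts (λ t → regroup (f x) _ (f x′)) ⟩
      ∑[ t ∈ ts ] (f x * f x′ * 𝟙 (κ x ≟ t))           ≡⟨ ∑-*ˡ (f x * f x′) _ ts ⟨
      f x * f x′ * ∑[ t ∈ ts ] 𝟙 (κ x ≟ t)             ≤⟨ *-monoʳ-≤ (f x * f x′) (∑-𝟙-≟ u (κ x)) ⟩
      f x * f x′ * 1                                   ∎
      where
      regroup : ∀ a i b → a * i * (b * 1) ≡ a * b * i
      regroup = solve-∀
    ... | no κx≢κx′ = ≤-trans (≤-reflexive (∑-zero ts (λ {t} _ → vanish t))) z≤n
      where
      vanish : ∀ t → pair x x′ t ≡ 0
      vanish t with κ x ≟ t | κ x′ ≟ t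
      ... | yes p | yes p′ = contradiction (trans p (sym p′)) κx≢κx′
      ... | yes _ | no _   = trans (cong (f x * 1 *_) (*-zeroʳ (f x′))) (*-zeroʳ (f x * 1))
      ... | no _  | d      = cong (_* (f x′ * 𝟙 d)) (*-zeroʳ (f x))

  -- Each `x` lies in at most one of the fibres, so cutting `f` into its restrictions to fibres does
  -- not increase the total sum of squares.
  ∑-fibre-squares-≤ : ∀ xs (f : A → ℕ) (κ : A → B) {ts} → Unique ts →
                      ∑[ t ∈ ts ] ∑[ x ∈ xs ] (f x * 𝟙 (κ x ≟ t) * (f x * 𝟙 (κ x ≟ t))) ≤ ∑[ x ∈ xs ] (f x * f x)
  ∑-fibre-squares-≤ xs f κ {ts} u = begin
    ∑[ t ∈ ts ] ∑[ x ∈ xs ] (f x * 𝟙 (κ x ≟ t) * (f x * 𝟙 (κ x ≟ t)))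
      ≡⟨ ∑-swap _ ts xs ⟩
    ∑[ x ∈ xs ] ∑[ t ∈ ts ] (f x * 𝟙 (κ x ≟ t) * (f x * 𝟙 (κ x ≟ t)))
      ≤⟨ ∑-mono xs (λ {x} _ → ∑-mono ts λ {t} _ → idempotent (f x) (𝟙≤1 (κ x ≟ t))) ⟩
    ∑[ x ∈ xs ] ∑[ t ∈ ts ] (f x * f x * 𝟙 (κ x ≟ t))
      ≡⟨ ∑-cong xs (λ x → ∑-*ˡ (f x * f x) _ ts) ⟨
    ∑[ x ∈ xs ] (f x * f x * ∑[ t ∈ ts ] 𝟙 (κ x ≟ t))
      ≤⟨ ∑-mono xs (λ {x} _ → *-monoʳ-≤ (f x * f x) (∑-𝟙-≟ u (κ x))) ⟩
    ∑[ x ∈ xs ] (f x * f x * 1)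
      ≡⟨ ∑-cong xs (λ x → *-identityʳ (f x * f x)) ⟩
    ∑[ x ∈ xs ] (f x * f x) ∎
    where
    open ≤-Reasoning
    regroup : ∀ a i → a * i * (a * 1) ≡ a * a * i
    regroup = solve-∀
    idempotent : ∀ a {i} → i ≤ 1 → a * i * (a * i) ≤ a * a * i
    idempotent a {i} i≤1 = ≤-trans (*-monoʳ-≤ (a * i) (*-monoʳ-≤ a i≤1)) (≤-reflexive (regroup a i))

  -- Cauchy-Schwarz over the fibres. It serves twice: with `ts` the whole field, for dot products,
  -- and with `ts` the attained distance vectors, for the final count.
  mass²≤fibres*energy : ∀ xs f κ {ts} → Unique ts → (∀ {x} → x ∈ xs → κ x ∈ ts) →
                        ∑ xs f * ∑ xs f ≤ length ts * energy xs f κ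
  mass²≤fibres*energy xs f κ {ts} u κ∈ts = begin
    ∑ xs f * ∑ xs f                         ≤⟨ *-mono-≤ mass≤ mass≤ ⟩
    ∑ ts ν * ∑ ts ν                         ≤⟨ cauchy-schwarz ν (λ _ → 1) (λ t → ν t * ν t) ts
                                                 (λ t → ≤-reflexive (sym (+-identityʳ _))) ⟩
    ∑[ t ∈ ts ] 1 * ∑[ t ∈ ts ] (ν t * ν t) ≤⟨ *-mono-≤ (≤-reflexive (trans (∑-const 1 ts) (*-identityʳ (length ts))))
                                                 (∑-fibreMass²-≤ xs f κ u) ⟩
    length ts * energy xs f κ               ∎
    where
    open ≤-Reasoning
    ν = fibreMass xs f κ
    mass≤ = ∑-fibreMass-≥ xs f κ ts κ∈ts

  energy-injective : ∀ {xs} f (κ : A → B) → (∀ {x y} → κ x ≡ κ y → x ≡ y) → Unique xs →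
                     energy xs f κ ≤ ∑[ x ∈ xs ] (f x * f x)
  energy-injective {xs} f κ κ-inj u = ∑-mono xs λ {x} _ → begin
    ∑[ x′ ∈ xs ] (f x * f x′ * 𝟙 (κ x ≟ κ x′)) ≡⟨ ∑-cong xs (diagonal x) ⟩
    ∑[ x′ ∈ xs ] (f x * f x * 𝟙 (κ x ≟ κ x′))  ≡⟨ ∑-*ˡ (f x * f x) _ xs ⟨
    f x * f x * ∑[ x′ ∈ xs ] 𝟙 (κ x ≟ κ x′)    ≤⟨ *-monoʳ-≤ (f x * f x) (∑-𝟙≤1 (λ x′ → κ x ≟ κ x′)
                                                    (λ p p′ → κ-inj (trans (sym p) p′)) u) ⟩
    f x * f x * 1                              ≡⟨ *-identityʳ _ ⟩
    f x * f x                                  ∎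
    where
    open ≤-Reasoning
    diagonal : ∀ x x′ → f x * f x′ * 𝟙 (κ x ≟ κ x′) ≡ f x * f x * 𝟙 (κ x ≟ κ x′)
    diagonal x x′ with κ x ≟ κ x′
    ... | yes p = cong (λ y → f x * f y * 1) (sym (κ-inj p))
    ... | no _  = trans (*-zeroʳ (f x * f x′)) (sym (*-zeroʳ (f x * f x)))

  -- The implication is asked only on `xs`, because passing from equal distances to equal dot
  -- products uses that the points lie on the sphere.
  energy-mono : ∀ xs f (κ κ′ : A → B) → (∀ {x x′} → x ∈ xs → x′ ∈ xs → κ x ≡ κ x′ → κ′ x ≡ κ′ x′) →
                energy xs f κ ≤ energy xs f κ′
  energy-mono xs f κ κ′ h = ∑-mono xs λ {x} x∈xs → ∑-mono xs λ {x′} x′∈xs →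
    *-monoʳ-≤ (f x * f x′) (𝟙-mono (κ x ≟ κ x′) (κ′ x ≟ κ′ x′) (h x∈xs x′∈xs))


-- Linear algebra over a finite field

module FieldProperties {q : ℕ} (F : FiniteField q) where
  open FiniteField F renaming (_+_ to infixl 6 _⊕_; _*_ to infixl 7 _⊗_; -_ to infix 8 ⊖_) public

  commutativeRing : CommutativeRing 0ℓ 0ℓ
  commutativeRing = record { isCommutativeRing = isCommutativeRing }

  module R = CommutativeRing commutativeRing
  module RP = RingProperties R.ring
  open SemiringSolver R.commutativeSemiring using (solve; _:+_; _:*_; _:=_)

  -- Cancellation and characteristic

  a≡b⊕[a⊖b] : ∀ a b → a ≡ b ⊕ (a ⊕ ⊖ b)
  a≡b⊕[a⊖b] a b = sym (trans (cong (b ⊕_) (R.+-comm a (⊖ b)))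
    (trans (sym (R.+-assoc b (⊖ b) a)) (trans (cong (_⊕ a) (R.-‿inverseʳ b)) (R.+-identityˡ a))))

  ⊕-cancelʳ : ∀ c {a b} → a ⊕ c ≡ b ⊕ c → a ≡ b
  ⊕-cancelʳ c {a} {b} = RP.+-cancelʳ c a b

  ⊗-cancelˡ : ∀ {c a b} → c ≢ 0# → c ⊗ a ≡ c ⊗ b → a ≡ b
  ⊗-cancelˡ {c} {a} {b} c≢0 eq with inverse c c≢0
  ... | c⁻¹ , cc⁻¹≡1 = trans (sym (undo a)) (trans (cong (c⁻¹ ⊗_) eq) (undo b))
    where
    undo : ∀ a → c⁻¹ ⊗ (c ⊗ a) ≡ a
    undo a = trans (sym (R.*-assoc c⁻¹ c a))
      (trans (cong (_⊗ a) (trans (R.*-comm c⁻¹ c) cc⁻¹≡1)) (R.*-identityˡ a))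

  -- Equal squares give `(a ⊕ b) ⊗ a ≡ (a ⊕ b) ⊗ b`, and the factor `a ⊕ b` cancels.
  square-injective-± : ∀ {a b} → a ⊗ a ≡ b ⊗ b → a ⊕ b ≢ 0# → a ≡ b
  square-injective-± {a} {b} eq a+b≢0 = ⊗-cancelˡ a+b≢0 (trans (R.distribʳ a a b)
    (trans (cong (_⊕ b ⊗ a) eq) (solve 2 (λ a b → b :* b :+ b :* a := (a :+ b) :* b) refl a b)))

  -- With `e` the difference of the slopes, both equations reduce to one linear equation,
  -- `e ⊗ z ⊕ a ≡ b`, whose slope is nonzero.
  affine-unique : ∀ {m n} a b s {z w} → m ≢ n →
                  a ⊕ (m ⊗ z ⊕ s) ≡ b ⊕ (n ⊗ z ⊕ s) → a ⊕ (m ⊗ w ⊕ s) ≡ b ⊕ (n ⊗ w ⊕ s) → z ≡ w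
  affine-unique {m} {n} a b s {z} {w} m≢n eqz eqw = ⊗-cancelˡ e≢0
    (⊕-cancelʳ a (trans (reduced z eqz) (sym (reduced w eqw))))
    where
    e = m ⊕ ⊖ n
    e≢0 : e ≢ 0#
    e≢0 e≡0 = m≢n (trans (a≡b⊕[a⊖b] m n) (trans (cong (n ⊕_) e≡0) (R.+-identityʳ n)))
    reduced : ∀ z → a ⊕ (m ⊗ z ⊕ s) ≡ b ⊕ (n ⊗ z ⊕ s) → e ⊗ z ⊕ a ≡ b
    reduced z eq = ⊕-cancelʳ (n ⊗ z ⊕ s) (trans
      (solve 5 (λ e a n z s → e :* z :+ a :+ (n :* z :+ s) := a :+ ((n :+ e) :* z :+ s)) refl e a n z s)
      (trans (cong (λ m → a ⊕ (m ⊗ z ⊕ s)) (sym (a≡b⊕[a⊖b] m n))) eq))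

  -- In characteristic 2 the relation y = x + 1 would be symmetric and irreflexive, so that it
  -- would pair up the q field elements.
  1+1≢0 : q % 2 ≡ 1 → 1# ⊕ 1# ≢ 0#
  1+1≢0 q-odd 1+1≡0 = contradiction
    (trans (sym q-odd) (n∣m⇒m%n≡0 q 2 (subst (2 ∣_) total even))) (λ ())
    where
    adjacent : Fin q → Fin q → ℕ
    adjacent x y = 𝟙 (x ⊕ 1# ≟ y)
    back : ∀ x → x ⊕ 1# ⊕ 1# ≡ x
    back x = trans (R.+-assoc x 1# 1#) (trans (cong (x ⊕_) 1+1≡0) (R.+-identityʳ x))
    flip : ∀ {x y} → x ⊕ 1# ≡ y → y ⊕ 1# ≡ x
    flip {x} eq = trans (cong (_⊕ 1#) (sym eq)) (back x)
    even : 2 ∣ ∑[ x ∈ allFin q ] ∑[ y ∈ allFin q ] adjacent x y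
    even = ∑∑-symmetric-even adjacent
      (λ x y → ≤-antisym (𝟙-mono (x ⊕ 1# ≟ y) (y ⊕ 1# ≟ x) flip) (𝟙-mono (y ⊕ 1# ≟ x) (x ⊕ 1# ≟ y) flip))
      (λ x → 𝟙-false (x ⊕ 1# ≟ x) λ eq → 0≢1 (sym (⊕-cancelʳ x
        (trans (R.+-comm 1# x) (trans eq (sym (R.+-identityˡ x)))))))
      (allFin q)
    row : ∀ x → ∑ (allFin q) (adjacent x) ≡ 1
    row x = ≤-antisym (Fibres.∑-𝟙-≟ {A = Fin q} _≟_ (allFin⁺ q) (x ⊕ 1#))
      (≤-trans (≤-reflexive (sym (𝟙-true (x ⊕ 1# ≟ x ⊕ 1#) refl))) (∈⇒≤∑ (adjacent x) (∈-allFin (x ⊕ 1#))))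
    total : ∑[ x ∈ allFin q ] ∑[ y ∈ allFin q ] adjacent x y ≡ q
    total = trans (∑-cong (allFin q) row)
      (trans (∑-const 1 (allFin q)) (trans (*-identityʳ _) (length-tabulate id)))

  double-injective : q % 2 ≡ 1 → ∀ {a b} → a ⊕ a ≡ b ⊕ b → a ≡ b
  double-injective q-odd {a} {b} eq = ⊗-cancelˡ (1+1≢0 q-odd) (trans (twice a) (trans eq (sym (twice b))))
    where
    twice : ∀ a → (1# ⊕ 1#) ⊗ a ≡ a ⊕ a
    twice a = trans (R.distribʳ a 1# 1#) (cong₂ _⊕_ (R.*-identityˡ a) (R.*-identityˡ a))

  -- Dot product, norm and scaling

  dot : ∀ {d} → Vec (Fin q) d → Vec (Fin q) d → Fin q
  dot []      []      = 0#
  dot (a ∷ x) (b ∷ y) = a ⊗ b ⊕ dot x y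

  -- The polarisation identity, with the subtracted term moved across. Writing `a` as `b ⊕ e` in
  -- each coordinate turns it into an identity between sums of products.
  norm-vsub : ∀ {d} (x y : Vec (Fin q) d) → norm F (vsub F x y) ⊕ (dot x y ⊕ dot x y) ≡ norm F x ⊕ norm F y
  norm-vsub []      []      = cong (0# ⊕_) (R.+-identityˡ 0#)
  norm-vsub (a ∷ x) (b ∷ y) =
    subst (λ a′ → e ⊗ e ⊕ norm F (vsub F x y) ⊕ (a′ ⊗ b ⊕ dot x y ⊕ (a′ ⊗ b ⊕ dot x y))
                  ≡ a′ ⊗ a′ ⊕ norm F x ⊕ (b ⊗ b ⊕ norm F y)) (sym (a≡b⊕[a⊖b] a b))
      (trans (solve 4 (λ b e n D → e :* e :+ n :+ ((b :+ e) :* b :+ D :+ ((b :+ e) :* b :+ D))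
                        := (b :+ e) :* (b :+ e) :+ b :* b :+ (n :+ (D :+ D))) refl
               b e (norm F (vsub F x y)) (dot x y))
      (trans (cong ((b ⊕ e) ⊗ (b ⊕ e) ⊕ b ⊗ b ⊕_) (norm-vsub x y))
        (solve 4 (λ s t u v → s :+ t :+ (u :+ v) := s :+ u :+ (t :+ v)) refl
          ((b ⊕ e) ⊗ (b ⊕ e)) (b ⊗ b) (norm F x) (norm F y))))
    where
    e = a ⊕ ⊖ b

  equidistant⇒dot≡ : q % 2 ≡ 1 → ∀ {d} {x x′ y : Vec (Fin q) d} → norm F x ≡ norm F x′ →
                     norm F (vsub F x y) ≡ norm F (vsub F x′ y) → dot x y ≡ dot x′ y
  equidistant⇒dot≡ q-odd {x = x} {x′} {y} ‖x‖≡‖x′‖ eq = double-injective q-odd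
    (RP.+-cancelˡ (norm F (vsub F x y)) _ _ (trans (norm-vsub x y) (trans (cong (_⊕ norm F y) ‖x‖≡‖x′‖)
      (trans (sym (norm-vsub x′ y)) (cong (_⊕ (dot x′ y ⊕ dot x′ y)) (sym eq))))))

  infixr 7 _•_
  _•_ : ∀ {d} → Fin q → Vec (Fin q) d → Vec (Fin q) d
  c • x = Vec.map (c ⊗_) x

  dot-• : ∀ {d} c (x y : Vec (Fin q) d) → dot x (c • y) ≡ c ⊗ dot x y
  dot-• c []      []      = sym (R.zeroʳ c)
  dot-• c (a ∷ x) (b ∷ y) = trans (cong (a ⊗ (c ⊗ b) ⊕_) (dot-• c x y))
    (solve 4 (λ a b c D → a :* (c :* b) :+ c :* D := c :* (a :* b :+ D)) refl a b c (dot x y))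

  norm-• : ∀ {d} c (x : Vec (Fin q) d) → norm F (c • x) ≡ c ⊗ c ⊗ norm F x
  norm-• c []      = sym (R.zeroʳ (c ⊗ c))
  norm-• c (a ∷ x) = trans (cong (c ⊗ a ⊗ (c ⊗ a) ⊕_) (norm-• c x))
    (solve 3 (λ a c n → c :* a :* (c :* a) :+ c :* c :* n := c :* c :* (a :* a :+ n)) refl a c (norm F x))

  •-injective : ∀ {d c} → c ≢ 0# → ∀ {x y : Vec (Fin q) d} → c • x ≡ c • y → x ≡ y
  •-injective c≢0 {[]}    {[]}    eq = refl
  •-injective c≢0 {_ ∷ _} {_ ∷ _} eq =
    cong₂ _∷_ (⊗-cancelˡ c≢0 (proj₁ (∷-injective eq))) (•-injective c≢0 (proj₂ (∷-injective eq)))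

  -- Points of the space and of its hyperplanes

  space : ∀ d → List (Vec (Fin q) d)
  space d = tuples d (allFin q)

  ∑-allFin-const : ∀ c → ∑[ x ∈ allFin q ] c ≡ q * c
  ∑-allFin-const c = trans (∑-const c (allFin q)) (cong (_* c) (length-tabulate {n = q} id))

  ∑-space-const : ∀ d c → ∑[ z ∈ space d ] c ≡ q ^ d * c
  ∑-space-const d c = trans (∑-tuples-const d c (allFin q))
    (cong (λ m → m ^ d * c) (length-tabulate {n = q} id))

  ≤∑-space : ∀ {d} (f : Vec (Fin q) d → ℕ) z → f z ≤ ∑ (space d) f
  ≤∑-space f []      = m≤m+n (f []) 0
  ≤∑-space {suc d} f (a ∷ z) = begin
    f (a ∷ z)                                    ≤⟨ ≤∑-space (λ v → f (a ∷ v)) z ⟩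
    ∑[ v ∈ space d ] f (a ∷ v)                   ≤⟨ ∈⇒≤∑ _ (∈-allFin a) ⟩
    ∑[ b ∈ allFin q ] ∑[ v ∈ space d ] f (b ∷ v) ≡⟨ ∑-tuples d (allFin q) f ⟨
    ∑ (space (suc d)) f                          ∎
    where open ≤-Reasoning

  -- The offsets `a` and `b` are there for the induction on `d`: a fixed first coordinate is
  -- absorbed into them. The factor `q` on the left avoids the exponent `d - 1`.
  hyperplane-card : ∀ {d} {x x′ : Vec (Fin q) d} a b → x ≢ x′ →
                    q * ∑[ z ∈ space d ] 𝟙 (a ⊕ dot x z ≟ b ⊕ dot x′ z) ≤ q ^ d
  hyperplane-card {x = []} {[]} a b x≢x′ = contradiction refl x≢x′
  hyperplane-card {suc d} {m ∷ x} {n ∷ x′} a b mx≢nx′ with ≡-dec _≟_ x x′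
  ... | no x≢x′ = begin
    q * ∑ (space (suc d)) _
      ≡⟨ cong (q *_) (∑-tuples d (allFin q) _) ⟩
    q * ∑[ c ∈ allFin q ] ∑[ z ∈ space d ] 𝟙 (a ⊕ (m ⊗ c ⊕ dot x z) ≟ b ⊕ (n ⊗ c ⊕ dot x′ z))
      ≡⟨ ∑-*ˡ q _ (allFin q) ⟩
    ∑[ c ∈ allFin q ] (q * ∑[ z ∈ space d ] 𝟙 (a ⊕ (m ⊗ c ⊕ dot x z) ≟ b ⊕ (n ⊗ c ⊕ dot x′ z)))
      ≡⟨ ∑-cong (allFin q) (λ c → cong (q *_) (∑-cong (space d) λ z →
           cong₂ (λ u v → 𝟙 (u ≟ v)) (sym (R.+-assoc a _ _)) (sym (R.+-assoc b _ _)))) ⟩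
    ∑[ c ∈ allFin q ] (q * ∑[ z ∈ space d ] 𝟙 (a ⊕ m ⊗ c ⊕ dot x z ≟ b ⊕ n ⊗ c ⊕ dot x′ z))
      ≤⟨ ∑-mono (allFin q) (λ {c} _ → hyperplane-card (a ⊕ m ⊗ c) (b ⊕ n ⊗ c) x≢x′) ⟩
    ∑[ c ∈ allFin q ] (q ^ d)
      ≡⟨ ∑-allFin-const (q ^ d) ⟩
    q ^ suc d ∎
    where open ≤-Reasoning
  -- The tails agree, so the heads differ: for every choice `z` of the other coordinates, at most
  -- one first coordinate solves the equation.
  ... | yes refl = *-monoʳ-≤ q (begin
    ∑ (space (suc d)) _
      ≡⟨ ∑-tuples d (allFin q) _ ⟩
    ∑[ c ∈ allFin q ] ∑[ z ∈ space d ] 𝟙 (a ⊕ (m ⊗ c ⊕ dot x z) ≟ b ⊕ (n ⊗ c ⊕ dot x z))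
      ≡⟨ ∑-swap _ (allFin q) (space d) ⟩
    ∑[ z ∈ space d ] ∑[ c ∈ allFin q ] 𝟙 (a ⊕ (m ⊗ c ⊕ dot x z) ≟ b ⊕ (n ⊗ c ⊕ dot x z))
      ≤⟨ ∑-mono (space d) (λ {z} _ → ∑-𝟙≤1 (λ c → a ⊕ (m ⊗ c ⊕ dot x z) ≟ b ⊕ (n ⊗ c ⊕ dot x z))
           (affine-unique a b (dot x z) λ m≡n → mx≢nx′ (cong (_∷ x) m≡n)) (allFin⁺ q)) ⟩
    ∑[ z ∈ space d ] 1
      ≡⟨ trans (∑-space-const d 1) (*-identityʳ _) ⟩
    q ^ d ∎)
    where open ≤-Reasoning

  -- Units and square roots

  #units : ℕ
  #units = ∑[ c ∈ allFin q ] 𝟙 (¬? (c ≟ 0#))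

  q≤1+#units : q ≤ suc #units
  q≤1+#units = begin
    q                                                   ≡⟨ trans (∑-allFin-const 1) (*-identityʳ q) ⟨
    ∑[ c ∈ allFin q ] 1                                 ≡⟨ ∑-cong (allFin q) split ⟩
    ∑[ c ∈ allFin q ] (𝟙 (0# ≟ c) + 𝟙 (¬? (c ≟ 0#)))   ≡⟨ ∑-+ (λ c → 𝟙 (0# ≟ c)) (λ c → 𝟙 (¬? (c ≟ 0#))) (allFin q) ⟩
    ∑[ c ∈ allFin q ] 𝟙 (0# ≟ c) + #units               ≤⟨ +-monoˡ-≤ #units (Fibres.∑-𝟙-≟ {A = Fin q} _≟_ (allFin⁺ q) 0#) ⟩
    suc #units                                          ∎
    where
    open ≤-Reasoning
    split : ∀ c → 1 ≡ 𝟙 (0# ≟ c) + 𝟙 (¬? (c ≟ 0#))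
    split c with c ≟ 0#
    ... | yes refl = sym (trans (+-identityʳ _) (𝟙-true (c ≟ c) refl))
    ... | no c≢0   = sym (cong (_+ 1) (𝟙-false (0# ≟ c) (c≢0 ∘ sym)))

  #units>0 : 1 ≤ #units
  #units>0 = ≤-trans (≤-reflexive (sym (𝟙-true (¬? (1# ≟ 0#)) (0≢1 ∘ sym))))
    (∈⇒≤∑ (λ c → 𝟙 (¬? (c ≟ 0#))) (∈-allFin 1#))

  -- Once a root `c` has been met, any later root `e` differs from `c`, hence satisfies
  -- `e ⊕ c ≡ 0#`, which has a single solution.
  #square-roots≤2 : ∀ n → ∑[ c ∈ allFin q ] 𝟙 (c ⊗ c ≟ n) ≤ 2
  #square-roots≤2 n = go (allFin⁺ q)
    where
    open ≤-Reasoning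
    go : ∀ {cs} → Unique cs → ∑[ c ∈ cs ] 𝟙 (c ⊗ c ≟ n) ≤ 2
    go [] = z≤n
    go {c ∷ cs} (c∉cs ∷ u) with c ⊗ c ≟ n
    ... | no _     = go u
    ... | yes c²≡n = s≤s (begin
      ∑[ e ∈ cs ] 𝟙 (e ⊗ e ≟ n)    ≤⟨ ∑-mono cs (λ {e} e∈cs → 𝟙-mono (e ⊗ e ≟ n) (e ⊕ c ≟ 0#) (other e∈cs)) ⟩
      ∑[ e ∈ cs ] 𝟙 (e ⊕ c ≟ 0#)   ≤⟨ ∑-𝟙≤1 (λ e → e ⊕ c ≟ 0#) (λ p p′ → ⊕-cancelʳ c (trans p (sym p′))) u ⟩
      1                            ∎)
      where
      other : ∀ {e} → e ∈ cs → e ⊗ e ≡ n → e ⊕ c ≡ 0#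
      other {e} e∈cs e²≡n with e ⊕ c ≟ 0#
      ... | yes p = p
      ... | no ≢0 = contradiction (sym (square-injective-± (trans e²≡n (sym c²≡n)) ≢0)) (All.lookup c∉cs e∈cs)

-- Incidences

  module Incidence {d : ℕ} {E : List (Vec (Fin q) d)} (E! : Unique E) (E⊆S : All (InSphere F) E)
                   (f : Vec (Fin q) d → ℕ) where
    open Fibres {A = Vec (Fin q) d} {B = Fin q} _≟_

    mass mass₂ : ℕ
    mass  = ∑ E f
    mass₂ = ∑[ x ∈ E ] (f x * f x)

    dotEnergy : Vec (Fin q) d → ℕ
    dotEnergy z = energy E f λ x → dot x z

    -- The deviation from the value attained when the dot products with `z` are equidistributed. The
    -- truncated subtraction is exact by `mass²≤q*dotEnergy`.
    excess : Vec (Fin q) d → ℕ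
    excess z = q * dotEnergy z ∸ mass * mass

    mass²≤q*dotEnergy : ∀ z → mass * mass ≤ q * dotEnergy z
    mass²≤q*dotEnergy z = subst (λ m → mass * mass ≤ m * dotEnergy z) (length-tabulate {n = q} id)
      (mass²≤fibres*energy E f (λ x → dot x z) (allFin⁺ q) (λ _ → ∈-allFin _))

    q*dotEnergy≡ : ∀ z → q * dotEnergy z ≡ excess z + mass * mass
    q*dotEnergy≡ z = sym (m∸n+n≡m (mass²≤q*dotEnergy z))

    excess-• : ∀ {c} z → c ≢ 0# → excess (c • z) ≡ excess z
    excess-• {c} z c≢0 = cong (λ e → q * e ∸ mass * mass) (≤-antisym
      (energy-mono E f _ _ λ {x} {x′} _ _ eq →
        ⊗-cancelˡ c≢0 (trans (sym (dot-• c x z)) (trans eq (dot-• c x′ z))))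
      (energy-mono E f _ _ λ {x} {x′} _ _ eq →
        trans (dot-• c x z) (trans (cong (c ⊗_) eq) (sym (dot-• c x′ z)))))

    -- For distinct points the `z` form a hyperplane. For equal points every `z` counts, and
    -- `q ≤ suc #units` splits off the same main term, leaving a surplus on the diagonal only.
    agreement-card : ∀ x x′ → q * ∑[ z ∈ space d ] 𝟙 (dot x z ≟ dot x′ z)
                              ≤ q ^ d + 𝟙 (≡-dec _≟_ x x′) * (#units * q ^ d)
    agreement-card x x′ with ≡-dec _≟_ x x′
    ... | no x≢x′ = begin
      q * ∑[ z ∈ space d ] 𝟙 (dot x z ≟ dot x′ z)
        ≡⟨ cong (q *_) (∑-cong (space d) λ z → sym (cong₂ (λ u v → 𝟙 (u ≟ v)) (R.+-identityˡ _) (R.+-identityˡ _))) ⟩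
      q * ∑[ z ∈ space d ] 𝟙 (0# ⊕ dot x z ≟ 0# ⊕ dot x′ z)
        ≤⟨ hyperplane-card 0# 0# x≢x′ ⟩
      q ^ d
        ≡⟨ +-identityʳ (q ^ d) ⟨
      q ^ d + 0 ∎
      where open ≤-Reasoning
    ... | yes _ = begin
      q * ∑[ z ∈ space d ] 𝟙 (dot x z ≟ dot x′ z)
        ≤⟨ *-mono-≤ q≤1+#units (∑-mono (space d) λ {z} _ → 𝟙≤1 (dot x z ≟ dot x′ z)) ⟩
      suc #units * ∑[ z ∈ space d ] 1
        ≡⟨ cong (suc #units *_) (trans (∑-space-const d 1) (*-identityʳ (q ^ d))) ⟩
      q ^ d + #units * q ^ d
        ≡⟨ cong (q ^ d +_) (+-identityʳ _) ⟨
      q ^ d + 1 * (#units * q ^ d) ∎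
      where open ≤-Reasoning

    -- Exchanging the sums leaves `agreement-card` for each pair of points. The first term is the
    -- equidistributed value, the second the diagonal surplus.
    ∑-dotEnergy : ∑[ z ∈ space d ] (q * dotEnergy z) ≤ q ^ d * (mass * mass) + #units * q ^ d * mass₂
    ∑-dotEnergy = begin
      ∑[ z ∈ space d ] (q * dotEnergy z)
        ≡⟨ ∑-*ˡ q dotEnergy (space d) ⟨
      q * ∑ (space d) dotEnergy
        ≡⟨ cong (q *_) (trans (∑-swap (λ z x → ∑[ x′ ∈ E ] term x x′ z) (space d) E)
             (∑-cong E λ x → ∑-swap (λ z x′ → term x x′ z) (space d) E)) ⟩
      q * ∑[ x ∈ E ] ∑[ x′ ∈ E ] ∑ (space d) (term x x′)
        ≡⟨ trans (∑-*ˡ q _ E) (∑-cong E λ x → trans (∑-*ˡ q _ E) (∑-cong E (factor x))) ⟩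
      ∑[ x ∈ E ] ∑[ x′ ∈ E ] (f x * f x′ * (q * ∑[ z ∈ space d ] 𝟙 (dot x z ≟ dot x′ z)))
        ≤⟨ ∑-mono E (λ {x} _ → ∑-mono E λ {x′} _ → *-monoʳ-≤ (f x * f x′) (agreement-card x x′)) ⟩
      ∑[ x ∈ E ] ∑[ x′ ∈ E ] (f x * f x′ * (q ^ d + 𝟙 (≡-dec _≟_ x x′) * (#units * q ^ d)))
        ≡⟨ ∑-cong E (λ x → trans (∑-cong E (expand x)) (∑-+ _ _ E)) ⟩
      ∑[ x ∈ E ] (∑[ x′ ∈ E ] (q ^ d * (f x * f x′))
                  + ∑[ x′ ∈ E ] (#units * q ^ d * (f x * f x′ * 𝟙 (≡-dec _≟_ x x′))))
        ≡⟨ ∑-+ _ _ E ⟩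
      ∑[ x ∈ E ] ∑[ x′ ∈ E ] (q ^ d * (f x * f x′))
        + ∑[ x ∈ E ] ∑[ x′ ∈ E ] (#units * q ^ d * (f x * f x′ * 𝟙 (≡-dec _≟_ x x′)))
        ≡⟨ cong₂ _+_ (pull (q ^ d) (λ x x′ → f x * f x′)) (pull (#units * q ^ d) _) ⟩
      q ^ d * ∑[ x ∈ E ] ∑[ x′ ∈ E ] (f x * f x′) + #units * q ^ d * Diagonal.energy E f id
        ≤⟨ +-mono-≤ (*-monoʳ-≤ (q ^ d) (≤-reflexive (sym (∑-*-∑ f f E E))))
             (*-monoʳ-≤ (#units * q ^ d) (Diagonal.energy-injective f id id E!)) ⟩
      q ^ d * (mass * mass) + #units * q ^ d * mass₂ ∎
      where
      open ≤-Reasoning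
      module Diagonal = Fibres {A = Vec (Fin q) d} (≡-dec (_≟_ {q}))
      term : Vec (Fin q) d → Vec (Fin q) d → Vec (Fin q) d → ℕ
      term x x′ z = f x * f x′ * 𝟙 (dot x z ≟ dot x′ z)
      rotate : ∀ a b c → a * (b * c) ≡ b * (a * c)
      rotate = solve-∀
      factor : ∀ x x′ → q * ∑ (space d) (term x x′) ≡ f x * f x′ * (q * ∑[ z ∈ space d ] 𝟙 (dot x z ≟ dot x′ z))
      factor x x′ = trans (cong (q *_) (sym (∑-*ˡ (f x * f x′) _ (space d)))) (rotate q (f x * f x′) _)
      distribute : ∀ a b c d → a * (b + c * d) ≡ b * a + d * (a * c)
      distribute = solve-∀
      expand : ∀ x x′ → f x * f x′ * (q ^ d + 𝟙 (≡-dec _≟_ x x′) * (#units * q ^ d))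
                        ≡ q ^ d * (f x * f x′) + #units * q ^ d * (f x * f x′ * 𝟙 (≡-dec _≟_ x x′))
      expand x x′ = distribute (f x * f x′) (q ^ d) (𝟙 (≡-dec _≟_ x x′)) (#units * q ^ d)
      pull : ∀ c (g : Vec (Fin q) d → Vec (Fin q) d → ℕ) →
             ∑[ x ∈ E ] ∑[ x′ ∈ E ] (c * g x x′) ≡ c * ∑[ x ∈ E ] ∑[ x′ ∈ E ] g x x′
      pull c g = trans (∑-cong E λ x → sym (∑-*ˡ c (g x) E)) (sym (∑-*ˡ c _ E))

    ∑-excess-space : ∑ (space d) excess ≤ #units * q ^ d * mass₂
    ∑-excess-space = +-cancelʳ-≤ (q ^ d * (mass * mass)) _ _ (begin
      ∑ (space d) excess + q ^ d * (mass * mass)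
        ≡⟨ cong (∑ (space d) excess +_) (∑-space-const d (mass * mass)) ⟨
      ∑ (space d) excess + ∑[ z ∈ space d ] (mass * mass)
        ≡⟨ ∑-+ excess _ (space d) ⟨
      ∑[ z ∈ space d ] (excess z + mass * mass)
        ≡⟨ ∑-cong (space d) q*dotEnergy≡ ⟨
      ∑[ z ∈ space d ] (q * dotEnergy z)
        ≤⟨ ∑-dotEnergy ⟩
      q ^ d * (mass * mass) + #units * q ^ d * mass₂
        ≡⟨ +-comm (q ^ d * (mass * mass)) _ ⟩
      #units * q ^ d * mass₂ + q ^ d * (mass * mass) ∎)
      where open ≤-Reasoning

    -- A nonzero multiple c y of a point y of the sphere has norm c², which determines c up to sign.
    multiples≤2 : ∀ z → ∑[ c ∈ allFin q ] (𝟙 (¬? (c ≟ 0#)) * ∑[ y ∈ E ] 𝟙 (≡-dec _≟_ (c • y) z)) ≤ 2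
    multiples≤2 z = ≤-trans (∑-mono (allFin q) λ {c} _ → row c) (#square-roots≤2 (norm F z))
      where
      row : ∀ c → 𝟙 (¬? (c ≟ 0#)) * ∑[ y ∈ E ] 𝟙 (≡-dec _≟_ (c • y) z) ≤ 𝟙 (c ⊗ c ≟ norm F z)
      row c with c ≟ 0#
      ... | yes _ = z≤n
      ... | no c≢0 with c ⊗ c ≟ norm F z
      ...   | yes _ = ≤-trans (≤-reflexive (+-identityʳ _))
                        (∑-𝟙≤1 (λ y → ≡-dec _≟_ (c • y) z) (λ p p′ → •-injective c≢0 (trans p (sym p′))) E!)
      ...   | no c²≢ = ≤-reflexive (trans (+-identityʳ _) (∑-zero E λ {y} y∈E →
                         𝟙-false (≡-dec _≟_ (c • y) z) λ cy≡z → c²≢ (trans (sym (R.*-identityʳ (c ⊗ c)))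
                           (trans (cong (c ⊗ c ⊗_) (sym (All.lookup E⊆S y∈E)))
                           (trans (sym (norm-• c y)) (cong (norm F) cy≡z))))))

    -- Spreading the excess of each `y` over its nonzero multiples multiplies the left side by
    -- `#units` and covers each point of the space at most twice. Cancelling `#units` therefore
    -- removes that factor from `∑-excess-space`.
    ∑-excess-E : ∑ E excess ≤ 2 * (q ^ d * mass₂)
    ∑-excess-E = *-cancelˡ-≤ #units {{>-nonZero #units>0}} (begin
      #units * ∑ E excess
        ≡⟨ ∑-*-∑ unit excess (allFin q) E ⟩
      ∑[ c ∈ allFin q ] ∑[ y ∈ E ] (unit c * excess y)
        -- Scale invariance moves the excess from `y` to `z = c • y`, one term of a sum over the
        -- space.
        ≤⟨ ∑-mono (allFin q) (λ {c} _ → ∑-mono E λ {y} _ → spread c y) ⟩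
      ∑[ c ∈ allFin q ] ∑[ y ∈ E ] ∑[ z ∈ space d ] (unit c * hit c y z * excess z)
        ≡⟨ ∑-cong (allFin q) (λ c → ∑-swap (λ y z → unit c * hit c y z * excess z) E (space d)) ⟩
      ∑[ c ∈ allFin q ] ∑[ z ∈ space d ] ∑[ y ∈ E ] (unit c * hit c y z * excess z)
        ≡⟨ ∑-swap (λ c z → ∑[ y ∈ E ] (unit c * hit c y z * excess z)) (allFin q) (space d) ⟩
      ∑[ z ∈ space d ] ∑[ c ∈ allFin q ] ∑[ y ∈ E ] (unit c * hit c y z * excess z)
        ≡⟨ ∑-cong (space d) (λ z → trans
             (∑-cong (allFin q) λ c → trans (sym (∑-*ʳ (excess z) (λ y → unit c * hit c y z) E))
               (cong (_* excess z) (sym (∑-*ˡ (unit c) (λ y → hit c y z) E))))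
             (sym (∑-*ʳ (excess z) (λ c → unit c * ∑[ y ∈ E ] hit c y z) (allFin q)))) ⟩
      ∑[ z ∈ space d ] (∑[ c ∈ allFin q ] (unit c * ∑[ y ∈ E ] hit c y z) * excess z)
        ≤⟨ ∑-mono (space d) (λ {z} _ → *-monoˡ-≤ (excess z) (multiples≤2 z)) ⟩
      ∑[ z ∈ space d ] (2 * excess z)
        ≡⟨ ∑-*ˡ 2 excess (space d) ⟨
      2 * ∑ (space d) excess
        ≤⟨ *-monoʳ-≤ 2 ∑-excess-space ⟩
      2 * (#units * q ^ d * mass₂)
        ≡⟨ regroup #units (q ^ d) mass₂ ⟩
      #units * (2 * (q ^ d * mass₂)) ∎)
      where
      open ≤-Reasoning
      unit : Fin q → ℕ
      unit c = 𝟙 (¬? (c ≟ 0#))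
      hit : Fin q → Vec (Fin q) d → Vec (Fin q) d → ℕ
      hit c y z = 𝟙 (≡-dec _≟_ (c • y) z)
      regroup : ∀ a b c → 2 * (a * b * c) ≡ a * (2 * (b * c))
      regroup = solve-∀
      spread : ∀ c y → unit c * excess y ≤ ∑[ z ∈ space d ] (unit c * hit c y z * excess z)
      spread c y with c ≟ 0#
      ... | yes _  = z≤n
      ... | no c≢0 = begin
        1 * excess y                           ≡⟨ cong (1 *_) (excess-• y c≢0) ⟨
        1 * excess (c • y)                     ≡⟨ cong (λ i → 1 * i * excess (c • y)) (𝟙-true (≡-dec _≟_ (c • y) (c • y)) refl) ⟨
        1 * hit c y (c • y) * excess (c • y)   ≤⟨ ≤∑-space (λ z → 1 * hit c y z * excess z) (c • y) ⟩
        ∑[ z ∈ space d ] (1 * hit c y z * excess z) ∎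

    distanceEnergy : Vec (Fin q) d → ℕ
    distanceEnergy y = energy E f λ x → norm F (vsub F x y)

    ∑-distanceEnergy : q % 2 ≡ 1 →
                       ∑[ y ∈ E ] (q * distanceEnergy y) ≤ length E * (mass * mass) + 2 * (q ^ d * mass₂)
    ∑-distanceEnergy q-odd = begin
      ∑[ y ∈ E ] (q * distanceEnergy y)
        -- On the sphere, two points equidistant from `y` have the same dot product with `y`.
        ≤⟨ ∑-mono E (λ {y} _ → *-monoʳ-≤ q (energy-mono E f _ _ λ {x} {x′} x∈E x′∈E →
             equidistant⇒dot≡ q-odd {x = x} {x′} {y}
               (trans (All.lookup E⊆S x∈E) (sym (All.lookup E⊆S x′∈E))))) ⟩
      ∑[ y ∈ E ] (q * dotEnergy y)
        ≡⟨ ∑-cong E (λ y → trans (q*dotEnergy≡ y) (+-comm (excess y) _)) ⟩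
      ∑[ y ∈ E ] (mass * mass + excess y)
        ≡⟨ trans (∑-+ _ excess E) (cong (_+ ∑ E excess) (∑-const (mass * mass) E)) ⟩
      length E * (mass * mass) + ∑ E excess
        ≤⟨ +-monoʳ-≤ (length E * (mass * mass)) ∑-excess-E ⟩
      length E * (mass * mass) + 2 * (q ^ d * mass₂) ∎
      where open ≤-Reasoning

-- Tuples of pins

  module Pins {d : ℕ} {E : List (Vec (Fin q) d)} (E! : Unique E) (E⊆S : All (InSphere F) E)
              (q-odd : q % 2 ≡ 1) (q>0 : 1 ≤ q) where

    module DistFibres (k : ℕ) = Fibres {A = Vec (Fin q) d} {B = Vec (Fin q) k} (≡-dec _≟_)

    dist : Vec (Fin q) d → Vec (Fin q) d → Fin q
    dist y x = norm F (vsub F x y)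

    -- The part of the weight at distance `s` from the pin `y`. Such restrictions absorb the first
    -- pin, which is why weights are arbitrary throughout.
    restrict : (Vec (Fin q) d → ℕ) → Vec (Fin q) d → Fin q → Vec (Fin q) d → ℕ
    restrict f y s x = f x * 𝟙 (dist y x ≟ s)

    tupleEnergy : ℕ → (Vec (Fin q) d → ℕ) → ℕ
    tupleEnergy k f = ∑[ ys ∈ tuples k E ] DistFibres.energy k E f (distVec F ys)

    -- Pairs that agree at all pins are sorted by their common distance `s` to the first pin `y`;
    -- agreement at `ys` remains.
    energy-∷ : ∀ {k} f y (ys : Vec (Vec (Fin q) d) k) →
               DistFibres.energy (suc k) E f (distVec F (y ∷ ys))
               ≤ ∑[ s ∈ allFin q ] DistFibres.energy k E (restrict f y s) (distVec F ys)
    energy-∷ {k} f y ys = begin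
      DistFibres.energy (suc k) E f (distVec F (y ∷ ys))
        ≤⟨ ∑-mono E (λ {x} _ → ∑-mono E λ {x′} _ → pointwise x x′) ⟩
      ∑[ x ∈ E ] ∑[ x′ ∈ E ] ∑[ s ∈ allFin q ] term s x x′
        ≡⟨ ∑-cong E (λ x → ∑-swap (λ x′ s → term s x x′) E (allFin q)) ⟩
      ∑[ x ∈ E ] ∑[ s ∈ allFin q ] ∑[ x′ ∈ E ] term s x x′
        ≡⟨ ∑-swap (λ x s → ∑[ x′ ∈ E ] term s x x′) E (allFin q) ⟩
      ∑[ s ∈ allFin q ] DistFibres.energy k E (restrict f y s) (distVec F ys) ∎
      where
      open ≤-Reasoning
      term : Fin q → Vec (Fin q) d → Vec (Fin q) d → ℕ
      term s x x′ = restrict f y s x * restrict f y s x′ * 𝟙 (≡-dec _≟_ (distVec F ys x) (distVec F ys x′))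
      pointwise : ∀ x x′ → f x * f x′ * 𝟙 (≡-dec _≟_ (distVec F (y ∷ ys) x) (distVec F (y ∷ ys) x′))
                           ≤ ∑[ s ∈ allFin q ] term s x x′
      pointwise x x′ = by (≡-dec _≟_ (distVec F (y ∷ ys) x) (distVec F (y ∷ ys) x′))
        where
        ones : ∀ a b → a * b * 1 ≡ a * 1 * (b * 1) * 1
        ones = solve-∀
        by : (eq? : Dec (distVec F (y ∷ ys) x ≡ distVec F (y ∷ ys) x′)) → f x * f x′ * 𝟙 eq? ≤ ∑[ s ∈ allFin q ] term s x x′
        by (no _)   = ≤-trans (≤-reflexive (*-zeroʳ (f x * f x′))) z≤n
        by (yes eq) = begin
          f x * f x′ * 1
            ≡⟨ ones (f x) (f x′) ⟩
          f x * 1 * (f x′ * 1) * 1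
            ≡⟨ cong₂ _*_ (cong₂ (λ i j → f x * i * (f x′ * j))
                 (𝟙-true (dist y x ≟ dist y x) refl)
                 (𝟙-true (dist y x′ ≟ dist y x) (sym (proj₁ (∷-injective eq)))))
                 (𝟙-true (≡-dec _≟_ (distVec F ys x) (distVec F ys x′)) (proj₂ (∷-injective eq))) ⟨
          term (dist y x) x x′
            ≤⟨ ∈⇒≤∑ (λ s → term s x x′) (∈-allFin (dist y x)) ⟩
          ∑[ s ∈ allFin q ] term s x x′ ∎

    tupleEnergy-suc : ∀ k f → tupleEnergy (suc k) f
                              ≤ ∑[ y ∈ E ] ∑[ s ∈ allFin q ] tupleEnergy k (restrict f y s)
    tupleEnergy-suc k f = begin
      tupleEnergy (suc k) f
        ≡⟨ ∑-tuples k E _ ⟩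
      ∑[ y ∈ E ] ∑[ ys ∈ tuples k E ] DistFibres.energy (suc k) E f (distVec F (y ∷ ys))
        ≤⟨ ∑-mono E (λ {y} _ → ∑-mono (tuples k E) λ {ys} _ → energy-∷ f y ys) ⟩
      ∑[ y ∈ E ] ∑[ ys ∈ tuples k E ] ∑[ s ∈ allFin q ] DistFibres.energy k E (restrict f y s) (distVec F ys)
        ≡⟨ ∑-cong E (λ y → ∑-swap (λ ys s → DistFibres.energy k E (restrict f y s) (distVec F ys))
             (tuples k E) (allFin q)) ⟩
      ∑[ y ∈ E ] ∑[ s ∈ allFin q ] tupleEnergy k (restrict f y s) ∎
      where open ≤-Reasoning

    n : ℕ
    n = length E

    mass mass₂ : (Vec (Fin q) d → ℕ) → ℕ
    mass f  = ∑ E f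
    mass₂ f = ∑[ x ∈ E ] (f x * f x)

    tupleEnergy-zero : ∀ f → tupleEnergy 0 f ≡ mass f * mass f
    tupleEnergy-zero f = trans (+-identityʳ _)
      (trans (∑-cong E λ x → ∑-cong E λ x′ → *-identityʳ (f x * f x′)) (sym (∑-*-∑ f f E E)))

    -- Divided by `n * q ^ suc k`, the right side is a main term `n^k mass² / q^k` and an error
    -- `2 k q^(d-1) n^(k-1) mass₂`; clearing denominators avoids the exponents `d - 1` and `k - 1`.
    -- The induction needs every weight `f`, as it passes to `restrict f y s`.
    tupleEnergy-≤ : ∀ k f → n * q ^ suc k * tupleEnergy k f
                            ≤ q * n ^ suc k * (mass f * mass f) + 2 * k * (q ^ (d + k) * n ^ k) * mass₂ f
    tupleEnergy-≤ zero f = ≤-reflexive (trans (cong (n * q ^ 1 *_) (tupleEnergy-zero f)) (regroup n q _))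
      where
      regroup : ∀ n q m → n * (q * 1) * m ≡ q * (n * 1) * m + 0
      regroup = solve-∀
    tupleEnergy-≤ (suc k) f = begin
      n * (q * X) * tupleEnergy (suc k) f
        ≤⟨ *-monoʳ-≤ (n * (q * X)) (tupleEnergy-suc k f) ⟩
      n * (q * X) * ∑[ y ∈ E ] ∑[ s ∈ allFin q ] tupleEnergy k (restrict f y s)
        ≡⟨ trans (cong (_* S) (shuffle n q X)) (*-assoc q (n * X) S) ⟩
      q * (n * X * ∑[ y ∈ E ] ∑[ s ∈ allFin q ] tupleEnergy k (restrict f y s))
        ≡⟨ cong (q *_) (trans (∑-*ˡ (n * X) _ E) (∑-cong E λ y → ∑-*ˡ (n * X) _ (allFin q))) ⟩
      q * ∑[ y ∈ E ] ∑[ s ∈ allFin q ] (n * X * tupleEnergy k (restrict f y s))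
        ≤⟨ *-monoʳ-≤ q (∑-mono E λ {y} _ → ∑-mono (allFin q) λ {s} _ → tupleEnergy-≤ k (restrict f y s)) ⟩
      q * ∑[ y ∈ E ] ∑[ s ∈ allFin q ] (q * N * (mass (restrict f y s) * mass (restrict f y s)) + C * mass₂ (restrict f y s))
        -- Over all `s`, the squared masses of the fibres add up to at most the energy of the single
        -- pin `y`, and the sums of squares to at most `mass₂ f`, so the error gains no factor `q`
        -- here.
        ≤⟨ *-monoʳ-≤ q (∑-mono E λ {y} _ → perPin y) ⟩
      q * ∑[ y ∈ E ] (N * (q * distanceEnergy y) + C * mass₂ f)
        ≡⟨ cong (q *_) (trans (∑-+ _ _ E) (cong₂ _+_ (sym (∑-*ˡ N _ E)) (∑-const (C * mass₂ f) E))) ⟩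
      q * (N * ∑[ y ∈ E ] (q * distanceEnergy y) + n * (C * mass₂ f))
        ≤⟨ *-monoʳ-≤ q (+-monoˡ-≤ (n * (C * mass₂ f)) (*-monoʳ-≤ N (∑-distanceEnergy q-odd))) ⟩
      q * (N * (n * (mass f * mass f) + 2 * (q ^ d * mass₂ f)) + n * (C * mass₂ f))
        ≡⟨ expand q N n (mass f * mass f) (q ^ d) (mass₂ f) k (q ^ (d + k)) (n ^ k) ⟩
      q * (n * N) * (mass f * mass f) + 2 * (q * q ^ d * N) * mass₂ f + 2 * k * (q * q ^ (d + k) * N) * mass₂ f
        -- The error of the new pin carries only `q ^ d`; raising it to `q ^ (d + k)` gives it the
        -- shape of the `k` earlier ones, so that `2 * k` becomes `2 * suc k`.
        ≤⟨ +-monoˡ-≤ _ (+-monoʳ-≤ (q * (n * N) * (mass f * mass f)) (*-monoˡ-≤ (mass₂ f) (*-monoʳ-≤ 2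
             (*-monoˡ-≤ N (*-monoʳ-≤ q (^-monoʳ-≤ q {{>-nonZero q>0}} (m≤m+n d k))))))) ⟩
      q * (n * N) * (mass f * mass f) + 2 * (q * q ^ (d + k) * N) * mass₂ f + 2 * k * (q * q ^ (d + k) * N) * mass₂ f
        ≡⟨ collect (q * (n * N) * (mass f * mass f)) (q * q ^ (d + k) * N) (mass₂ f) k ⟩
      q * (n * N) * (mass f * mass f) + 2 * suc k * (q * q ^ (d + k) * N) * mass₂ f
        ≡⟨ cong (λ e → q * (n * N) * (mass f * mass f) + 2 * suc k * (q ^ e * N) * mass₂ f) (+-suc d k) ⟨
      q * (n * N) * (mass f * mass f) + 2 * suc k * (q ^ (d + suc k) * N) * mass₂ f ∎
      where
      open ≤-Reasoning
      open Incidence E! E⊆S f using (distanceEnergy; ∑-distanceEnergy)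
      open Fibres {A = Vec (Fin q) d} {B = Fin q} _≟_ using (∑-fibreMass²-≤; ∑-fibre-squares-≤)
      X = q ^ suc k
      N = n ^ suc k
      C = 2 * k * (q ^ (d + k) * n ^ k)
      S = ∑[ y ∈ E ] ∑[ s ∈ allFin q ] tupleEnergy k (restrict f y s)
      shuffle : ∀ n q X → n * (q * X) ≡ q * (n * X)
      shuffle = solve-∀
      assoc : ∀ q N e → q * N * e ≡ N * (q * e)
      assoc = solve-∀
      expand : ∀ q N n m D m₂ k T n^k →
               q * (N * (n * m + 2 * (D * m₂)) + n * (2 * k * (T * n^k) * m₂))
               ≡ q * (n * N) * m + 2 * (q * D * N) * m₂ + 2 * k * (q * T * (n * n^k)) * m₂
      expand = solve-∀
      collect : ∀ a t m k → a + 2 * t * m + 2 * k * t * m ≡ a + 2 * suc k * t * m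
      collect = solve-∀
      perPin : ∀ y → ∑[ s ∈ allFin q ] (q * N * (mass (restrict f y s) * mass (restrict f y s)) + C * mass₂ (restrict f y s))
                     ≤ N * (q * distanceEnergy y) + C * mass₂ f
      perPin y = begin
        ∑[ s ∈ allFin q ] (q * N * (mass (restrict f y s) * mass (restrict f y s)) + C * mass₂ (restrict f y s))
          ≡⟨ trans (∑-+ _ _ (allFin q)) (sym (cong₂ _+_ (∑-*ˡ (q * N) _ (allFin q)) (∑-*ˡ C _ (allFin q)))) ⟩
        q * N * ∑[ s ∈ allFin q ] (mass (restrict f y s) * mass (restrict f y s)) + C * ∑[ s ∈ allFin q ] mass₂ (restrict f y s)
          ≤⟨ +-mono-≤ (*-monoʳ-≤ (q * N) (∑-fibreMass²-≤ E f (dist y) (allFin⁺ q)))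
               (*-monoʳ-≤ C (∑-fibre-squares-≤ E f (dist y) (allFin⁺ q))) ⟩
        q * N * distanceEnergy y + C * mass₂ f
          ≡⟨ cong (_+ C * mass₂ f) (assoc q N (distanceEnergy y)) ⟩
        N * (q * distanceEnergy y) + C * mass₂ f ∎

    -- The distinct distance vectors index the nonempty fibres of `distVec F ys`, so few of them
    -- would force a large energy.
    pinnedCard-energy : ∀ {k} (ys : Vec (Vec (Fin q) d) k) →
                        n * n ≤ pinnedCard F E ys * DistFibres.energy k E (λ _ → 1) (distVec F ys)
    pinnedCard-energy {k} ys = subst (λ m → m * m ≤ pinnedCard F E ys * DistFibres.energy k E (λ _ → 1) (distVec F ys))
      (trans (∑-const 1 E) (*-identityʳ n))
      (DistFibres.mass²≤fibres*energy k E (λ _ → 1) (distVec F ys) (deduplicate-! (≡-dec _≟_) _)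
        (λ x∈E → ∈-deduplicate⁺ (≡-dec _≟_) (∈-map⁺ (distVec F ys) x∈E)))

    -- A second Cauchy-Schwarz, now over the tuples of pins, with `pinnedCard-energy` as its
    -- pointwise hypothesis and the constant `n` as `f`.
    ∑-pinnedCard-energy : ∀ k → n ^ k * n * (n ^ k * n)
                                ≤ ∑ (tuples k E) (pinnedCard F E) * tupleEnergy k (λ _ → 1)
    ∑-pinnedCard-energy k = subst (λ m → m * m ≤ ∑ (tuples k E) (pinnedCard F E) * tupleEnergy k (λ _ → 1))
      (∑-tuples-const k n E)
      (cauchy-schwarz (λ _ → n) (pinnedCard F E) _ (tuples k E) pinnedCard-energy)

-- From the energy bound to the number of distance vectors

-- Here `X` stands for `q ^ k`, `N` for `n ^ k`, `T` for the power of `q` in the size hypothesis,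
-- `D` for the sum of the pinned cardinalities and `M` for the tuple energy. The unknown `M` is
-- eliminated between its two bounds.
combine : ∀ k a b n X N T D M → 1 ≤ n → 1 ≤ N →
          N * n * (N * n) ≤ D * M →
          n * X * M ≤ n * N * (n * n) + 2 * k * (T * N) * n →
          a * T ≤ b * (n * n) →
          a * X * N ≤ (a + 2 * k * b) * D
combine k a b n X N T D M n>0 N>0 cs en hyp =
  *-cancelʳ-≤ _ _ (n * n * n * N)
    {{>-nonZero (*-mono-≤ (*-mono-≤ (*-mono-≤ n>0 n>0) n>0) N>0)}} (begin
    a * X * N * (n * n * n * N)                             ≡⟨ r₁ a X N n ⟩
    a * (n * X) * (N * n * (N * n))                         ≤⟨ *-monoʳ-≤ (a * (n * X)) cs ⟩
    a * (n * X) * (D * M)                                   ≡⟨ r₂ a n X D M ⟩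
    a * D * (n * X * M)                                     ≤⟨ *-monoʳ-≤ (a * D) en ⟩
    a * D * (n * N * (n * n) + 2 * k * (T * N) * n)         ≡⟨ r₃ a D n N k T ⟩
    -- The size of `E` enters here: it makes the error at most `2 * k * b / a` times the main term.
    D * N * n * (a * (n * n) + 2 * k * (a * T))             ≤⟨ *-monoʳ-≤ (D * N * n)
                                                                 (+-monoʳ-≤ (a * (n * n)) (*-monoʳ-≤ (2 * k) hyp)) ⟩
    D * N * n * (a * (n * n) + 2 * k * (b * (n * n)))       ≡⟨ r₄ a D n N k b ⟩
    (a + 2 * k * b) * D * (n * n * n * N)                   ∎)
  where
  open ≤-Reasoning
  r₁ : ∀ a X N n → a * X * N * (n * n * n * N) ≡ a * (n * X) * (N * n * (N * n))
  r₁ = solve-∀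
  r₂ : ∀ a n X D M → a * (n * X) * (D * M) ≡ a * D * (n * X * M)
  r₂ = solve-∀
  r₃ : ∀ a D n N k T → a * D * (n * N * (n * n) + 2 * k * (T * N) * n)
                       ≡ D * N * n * (a * (n * n) + 2 * k * (a * T))
  r₃ = solve-∀
  r₄ : ∀ a D n N k b → D * N * n * (a * (n * n) + 2 * k * (b * (n * n))) ≡ (a + 2 * k * b) * D * (n * n * n * N)
  r₄ = solve-∀

odd⇒>0 : ∀ {q} → q % 2 ≡ 1 → 1 ≤ q
odd⇒>0 {suc q} _ = s≤s z≤n

pinned-bound : ∀ d k → 1 ≤ k → ∀ a b {q} → q % 2 ≡ 1 → (F : FiniteField q) →
               (E : List (Vec (Fin q) d)) → Unique E → All (InSphere F) E →
               a * q ^ (d + k ∸ 1) ≤ b * (length E * length E) →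
               a * q ^ k * length E ^ k ≤ (a + 2 * k * b) * ∑ (tuples k E) (pinnedCard F E)
-- For empty `E` the left side vanishes, since at least one pin makes `0 ^ suc k` zero.
pinned-bound d (suc k) k>0 a b {q} q-odd F [] E! E⊆S hyp = ≤-trans (≤-reflexive (*-zeroʳ (a * q ^ suc k))) z≤n
-- In dimension 0 the only vector has norm `0#`, so the unit sphere is empty.
pinned-bound zero k k>0 a b q-odd F ([] ∷ E) E! (0≡1 ∷ _) hyp = contradiction 0≡1 (FiniteField.0≢1 F)
-- In dimension `suc d` the truncated exponent `suc d + k ∸ 1` is `d + k`, the power of `q` left in
-- the error once `energy-bound` cancels one factor `q`.
pinned-bound (suc d) k k>0 a b {q} q-odd F E@(_ ∷ _) E! E⊆S hyp =
  combine k a b n (q ^ k) (n ^ k) (q ^ (d + k)) _ (tupleEnergy k (λ _ → 1)) (s≤s z≤n) (m^n>0 n k)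
    (∑-pinnedCard-energy k) energy-bound hyp
  where
  open FieldProperties F
  q>0 = odd⇒>0 q-odd
  open Pins E! E⊆S q-odd q>0
  open ≤-Reasoning
  M = tupleEnergy k (λ _ → 1)
  count : ∑[ x ∈ E ] 1 ≡ n
  count = trans (∑-const 1 E) (*-identityʳ n)
  r₁ : ∀ q n X M → q * (n * X * M) ≡ n * (q * X) * M
  r₁ = solve-∀
  r₂ : ∀ q nN m k T N n → q * nN * m + 2 * k * (q * T * N) * n ≡ q * (nN * m + 2 * k * (T * N) * n)
  r₂ = solve-∀
  energy-bound : n * q ^ k * M ≤ n * n ^ k * (n * n) + 2 * k * (q ^ (d + k) * n ^ k) * n
  energy-bound = *-cancelˡ-≤ q {{>-nonZero q>0}} (begin
    q * (n * q ^ k * M)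
      ≡⟨ r₁ q n (q ^ k) M ⟩
    n * q ^ suc k * M
      ≤⟨ tupleEnergy-≤ k (λ _ → 1) ⟩
    q * n ^ suc k * (∑[ x ∈ E ] 1 * ∑[ x ∈ E ] 1) + 2 * k * (q ^ (suc d + k) * n ^ k) * ∑[ x ∈ E ] 1
      ≡⟨ cong (λ m → q * n ^ suc k * (m * m) + 2 * k * (q ^ (suc d + k) * n ^ k) * m) count ⟩
    q * n ^ suc k * (n * n) + 2 * k * (q ^ (suc d + k) * n ^ k) * n
      ≡⟨ r₂ q (n ^ suc k) (n * n) k (q ^ (d + k)) (n ^ k) n ⟩
    q * (n * n ^ k * (n * n) + 2 * k * (q ^ (d + k) * n ^ k) * n) ∎)

-- The implied constants are the positive rationals `a₀ / b₀` and `a / b`; squaring the size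
-- hypothesis removes the half-integral exponent.
theorem2p15 : (d k : ℕ) → 1 ≤ k → (a₀ b₀ : ℕ) → 1 ≤ a₀ → 1 ≤ b₀ →
    Σ ℕ λ a → Σ ℕ λ b → 1 ≤ a × 1 ≤ b ×
    ((q : ℕ) → q % 2 ≡ 1 → (F : FiniteField q) →
    (E : List (Vec (Fin q) d)) → Unique E → All (InSphere F) E →
    a₀ * a₀ * q ^ (d + k ∸ 1) ≤ b₀ * b₀ * (length E * length E) →
    a * q ^ k * length E ^ k ≤ b * sum (map (pinnedCard F E) (tuples k E)))
theorem2p15 d k k>0 a₀ b₀ a₀>0 _ =
  -- The constant `a₀² / (a₀² + 2 k b₀²)` is the main term's share of the energy bound; it depends
  -- on neither `q` nor `E`.
  a₀ * a₀ , a₀ * a₀ + 2 * k * (b₀ * b₀) , a>0 , ≤-trans a>0 (m≤m+n _ _) ,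
  λ q q-odd F E E! E⊆S hyp → pinned-bound d k k>0 (a₀ * a₀) (b₀ * b₀) q-odd F E E! E⊆S hyp
  where
  a>0 = *-mono-≤ a₀>0 a₀>0
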